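{- For every formula $A$: $A$ is a theorem of the provability logic $\mathsf{GL}$ if and only if the one-element sequent $A$ is cut-free provable in the nested sequent calculus (rules (id), ($\land$), ($\lor$), ($\Box$), ($\Diamond$)).
   Context: $\mathsf{GL}$ is the normal modal logic obtained from $\mathsf{K}$ by adding the Löb axiom $\Box(\Box A\to A)\to\Box A$; a formula of the language below is read in $\mathsf{GL}$ by interpreting $\alpha^\perp$ as $\neg\alpha$ and $\Diamond$ as $\neg\Box\neg$. Fix a countable set of atoms; each atom $\alpha$ has a dual negative atom $\alpha^\perp$. Formulas: $A,B ::= \alpha \mid \alpha^\perp \mid A\land B \mid A\lor B \mid \Box A \mid \Diamond A$. Negation $A^\perp$ is defined by $(\alpha)^\perp=\alpha^\perp$, $(\alpha^\perp)^\perp=\alpha$, $(A\land B)^\perp=A^\perp\lor B^\perp$, $(A\lor B)^\perp=A^\perp\land B^\perp$, $(\Box A)^\perp=\Diamond A^\perp$, $(\Diamond A)^\perp=\Box A^\perp$. A (nested) sequent is given by $\Gamma,\Delta ::= \cdot \mid \Gamma, A \mid \Gamma, [\Delta]$, where $\cdot$ is the empty sequent; sequents are taken up to exchange (finite multisets of formulas and bracketed sequents), and $\Gamma,\Delta$ denotes juxtaposition. A unary context is given by $\Gamma\{ -\} ::= \Delta,\{ -\} \mid \Delta,[\Gamma\{ -\}]$ (a sequent with exactly one hole); $\Gamma\{\Delta\}$ is the result of filling the hole with $\Delta$, and $\Gamma\{\}$ means $\Gamma\{\cdot\}$. Depth: $\mathrm{depth}(\Delta,\{ -\})=0$, $\mathrm{depth}(\Delta,[\Gamma\{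 -\}])=\mathrm{depth}(\Gamma\{ -\})+1$. Rules: (id) $\Gamma\{\alpha^\perp,\alpha\}$ with no premises ($\alpha$ an atom); ($\land$) from $\Gamma\{A\}$ and $\Gamma\{B\}$ infer $\Gamma\{A\land B\}$; ($\lor$) from $\Gamma\{A,B\}$ infer $\Gamma\{A\lor B\}$; ($\Box$) from $\Gamma\{[\Diamond A^\perp, A]\}$ infer $\Gamma\{\Box A\}$; ($\Diamond$) from $\Gamma\{\Delta\{A\},\Diamond A\}$ infer $\Gamma\{\Delta\{\},\Diamond A\}$, provided $\mathrm{depth}(\Delta\{ -\})>0$; (cut) from $\Gamma\{A\}$ and $\Gamma\{A^\perp\}$ infer $\Gamma\{\}$. "Cut-free provable" means derivable using (id), ($\land$), ($\lor$), ($\Box$), ($\Diamond$) only. -}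

module Defs where

open import Data.Bool using (Bool; true; false; not) renaming (_∧_ to _∧ᵇ_; _∨_ to _∨ᵇ_)
open import Data.List using (List; []; _∷_; [_]; _++_)
open import Data.List.Relation.Binary.Permutation.Homogeneous using (Permutation)
open import Data.Nat using (ℕ; zero; suc; _>_)
open import Relation.Binary.PropositionalEquality using (_≡_)

Atom : Set
Atom = ℕ

infix  9 □_ ◇_ _ᗮ
infixr 7 _∧_
infixr 6 _∨_

data Formula : Set where
  pos : Atom → Formula
  neg : Atom → Formula
  _∧_ : Formula → Formula → Formula
  _∨_ : Formula → Formula → Formula
  □_  : Formula → Formula
  ◇_  : Formula → Formula

_ᗮ : Formula → Formula
pos a ᗮ   = neg a
neg a ᗮ   = pos a
(A ∧ B) ᗮ = (A ᗮ) ∨ (B ᗮ)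
(A ∨ B) ᗮ = (A ᗮ) ∧ (B ᗮ)
(□ A) ᗮ   = ◇ (A ᗮ)
(◇ A) ᗮ   = □ (A ᗮ)

data Item : Set where
  fm  : Formula → Item
  box : List Item → Item

Sequent : Set
Sequent = List Item

-- Exchange is allowed at every depth, so that sequents modulo _≈_ are
-- hereditarily finite multisets.
data _≈ᵢ_ : Item → Item → Set where
  fm  : ∀ {A} → fm A ≈ᵢ fm A
  box : ∀ {Γ Δ} → Permutation _≈ᵢ_ Γ Δ → box Γ ≈ᵢ box Δ

infix 4 _≈ᵢ_ _≈_

_≈_ : Sequent → Sequent → Set
_≈_ = Permutation _≈ᵢ_

-- hole Δ is  Δ, {-}  and  under Δ Γ  is  Δ, [Γ{-}].
data Context : Set where
  hole  : Sequent → Context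
  under : Sequent → Context → Context

infix 8 _⟪_⟫

_⟪_⟫ : Context → Sequent → Sequent
hole Δ ⟪ Σ ⟫    = Δ ++ Σ
under Δ Γ ⟪ Σ ⟫ = Δ ++ [ box (Γ ⟪ Σ ⟫) ]

depth : Context → ℕ
depth (hole Δ)    = zero
depth (under Δ Γ) = suc (depth Γ)

infix 3 CutFree_

data CutFree_ : Sequent → Set where
  exch : ∀ {Γ Δ} → Γ ≈ Δ → CutFree Γ → CutFree Δ
  idR  : ∀ (Γ : Context) a →
         CutFree Γ ⟪ fm (neg a) ∷ fm (pos a) ∷ [] ⟫
  ∧R   : ∀ (Γ : Context) A B →
         CutFree Γ ⟪ [ fm A ] ⟫ →
         CutFree Γ ⟪ [ fm B ] ⟫ →
         CutFree Γ ⟪ [ fm (A ∧ B) ] ⟫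
  ∨R   : ∀ (Γ : Context) A B →
         CutFree Γ ⟪ fm A ∷ fm B ∷ [] ⟫ →
         CutFree Γ ⟪ [ fm (A ∨ B) ] ⟫
  □R   : ∀ (Γ : Context) A →
         CutFree Γ ⟪ [ box (fm (◇ (A ᗮ)) ∷ fm A ∷ []) ] ⟫ →
         CutFree Γ ⟪ [ fm (□ A) ] ⟫
  ◇R   : ∀ (Γ Δ : Context) A → depth Δ > 0 →
         CutFree Γ ⟪ Δ ⟪ [ fm A ] ⟫ ++ [ fm (◇ A) ] ⟫ →
         CutFree Γ ⟪ Δ ⟪ [] ⟫ ++ [ fm (◇ A) ] ⟫

infixr 5 _⇒′_
infixr 7 _∧′_
infixr 6 _∨′_
infix  9 □′_ ¬′_ ◇′_

data Modal : Set where
  var  : Atom → Modal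
  ⊥′   : Modal
  _⇒′_ : Modal → Modal → Modal
  _∧′_ : Modal → Modal → Modal
  _∨′_ : Modal → Modal → Modal
  □′_  : Modal → Modal

¬′_ : Modal → Modal
¬′ A = A ⇒′ ⊥′

◇′_ : Modal → Modal
◇′ A = ¬′ (□′ (¬′ A))

-- Boxed formulas are assigned arbitrary truth values, like atoms, so that
-- Tautology holds exactly of the substitution instances of classical
-- propositional tautologies.
eval : (Atom → Bool) → (Modal → Bool) → Modal → Bool
eval v w (var a)  = v a
eval v w ⊥′       = false
eval v w (A ⇒′ B) = not (eval v w A) ∨ᵇ eval v w B
eval v w (A ∧′ B) = eval v w A ∧ᵇ eval v w B
eval v w (A ∨′ B) = eval v w A ∨ᵇ eval v w B
eval v w (□′ A)   = w A

Tautology : Modal → Set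
Tautology A = ∀ v w → eval v w A ≡ true

infix 3 GL⊢_

-- Axioms are schematic, so closure under uniform substitution is admissible.
data GL⊢_ : Modal → Set where
  taut : ∀ {A} → Tautology A → GL⊢ A
  K    : ∀ {A B} → GL⊢ □′ (A ⇒′ B) ⇒′ (□′ A ⇒′ □′ B)
  löb  : ∀ {A} → GL⊢ □′ (□′ A ⇒′ A) ⇒′ □′ A
  mp   : ∀ {A B} → GL⊢ A ⇒′ B → GL⊢ A → GL⊢ B
  nec  : ∀ {A} → GL⊢ A → GL⊢ □′ A

⌜_⌝ : Formula → Modal
⌜ pos a ⌝ = var a
⌜ neg a ⌝ = ¬′ var a
⌜ A ∧ B ⌝ = ⌜ A ⌝ ∧′ ⌜ B ⌝
⌜ A ∨ B ⌝ = ⌜ A ⌝ ∨′ ⌜ B ⌝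
⌜ □ A ⌝   = □′ ⌜ A ⌝
⌜ ◇ A ⌝   = ◇′ ⌜ A ⌝

{-# OPTIONS --safe #-}
module Submission where

-- Soundness reads a sequent as the disjunction of its items, with brackets read as □; the rule (□)
-- is then Löb's axiom and the rule (◇) is transitivity.
--
-- For completeness, work only at the leaf of a single branch of a nested sequent: besides its own
-- formulas, a leaf needs to know only which ◇-formulas occur above it. Proof search in
-- this leaf calculus ends in a proof or in a finite tree refuting the formula, and GL is
-- sound for finite trees ordered by strict descent. The search is finite because unfolding □A leaves
-- ◇Aᗮ behind, so that a second □A on the same branch is provable by an identity on A.

open import Defs
open import Data.Bool using (Bool; true; false; not) renaming (_∧_ to _∧ᵇ_; _∨_ to _∨ᵇ_)
open import Data.Bool.Properties using (∨-zeroʳ)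
open import Data.List using (List; []; _∷_; [_]; _++_; length; map)
open import Data.List.Membership.DecPropositional using (_∈?_)
open import Data.List.Membership.Propositional using (_∈_; find; lose)
open import Data.List.Membership.Propositional.Properties using (∈-++⁺ˡ; ∈-++⁺ʳ; ∈-++⁻; ∈-map⁺; ∈-∃++)
open import Data.List.Properties using (++-assoc; ++-identityʳ; map-++)
open import Data.List.Relation.Binary.Permutation.Homogeneous using (refl; prep; swap; trans)
open import Data.List.Relation.Binary.Permutation.Propositional as ↭ using (_↭_; ↭-refl; ↭-sym; ↭-trans; ↭-prep; ↭-swap; ↭-reflexive)
open import Data.List.Relation.Binary.Permutation.Propositional.Properties using (map⁺; shift; shifts; ++-comm; ++⁺ˡ; ++⁺ʳ; ∷↭∷ʳ; ↭-length; ∈-resp-↭; All-resp-↭)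
open import Data.List.Relation.Binary.Pointwise using (Pointwise; []; _∷_)
open import Data.List.Relation.Unary.All as All using (All; []; _∷_)
import Data.List.Relation.Unary.All.Properties as All
open import Data.List.Relation.Unary.Any using (Any; here; there; any?)
open import Data.Nat using (ℕ; suc; _+_; _≤_; _>_; z≤n; s≤s; _≟_)
open import Data.Nat.ListAction using (sum)
open import Data.Nat.Properties using (≤-refl; ≤-trans; ≤-reflexive; +-assoc; m≤m+n; m≤n+m; +-monoˡ-≤)
open import Data.Product using (∃; _×_; _,_; proj₁; proj₂)
open import Data.Sum using (_⊎_; inj₁; inj₂; [_,_]′; map₁; map₂)
open import Function using (_∘_; case_of_)
open import Function.Bundles using (_⇔_; mk⇔)
open import Relation.Binary.PropositionalEquality using (_≡_; cong; cong₂; subst) renaming (refl to ≡-refl; sym to ≡-sym; trans to ≡-trans)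
open import Relation.Nullary using (¬_; yes; no)
open import Relation.Nullary.Decidable using (does; dec-true; dec-false)

-- Classical propositional reasoning

∧ᵇ-true⁻ : ∀ a {b} → a ∧ᵇ b ≡ true → a ≡ true × b ≡ true
∧ᵇ-true⁻ true p = ≡-refl , p

-- A record in place of the bare equation keeps `A` visible to unification, which `eval` would
-- otherwise compute away.
record Holds (v : Atom → Bool) (w : Modal → Bool) (A : Modal) : Set where
  constructor ⟨_⟩
  field holds : eval v w A ≡ true
open Holds

module _ {v : Atom → Bool} {w : Modal → Bool} where

  private
    infix 3 ⊩_
    ⊩_ : Modal → Set
    ⊩ A = Holds v w A

  ⊥′-elim : ∀ {A} → ⊩ ⊥′ → ⊩ A
  ⊥′-elim ⟨ () ⟩

  ⇒-intro : ∀ {A B} → (⊩ A → ⊩ B) → ⊩ A ⇒′ B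
  ⇒-intro {A} f = ⟨ lemma (eval v w A) (λ eq → holds (f ⟨ eq ⟩)) ⟩
    where
    lemma : ∀ a {b} → (a ≡ true → b ≡ true) → not a ∨ᵇ b ≡ true
    lemma true  g = g ≡-refl
    lemma false g = ≡-refl

  ⇒-elim : ∀ {A B} → ⊩ A ⇒′ B → ⊩ A → ⊩ B
  ⇒-elim {A} ⟨ f ⟩ ⟨ a ⟩ rewrite a = ⟨ f ⟩

  ∧-intro : ∀ {A B} → ⊩ A → ⊩ B → ⊩ A ∧′ B
  ∧-intro ⟨ a ⟩ ⟨ b ⟩ = ⟨ cong₂ _∧ᵇ_ a b ⟩

  ∧-elim : ∀ {A B} → ⊩ A ∧′ B → (⊩ A) × (⊩ B)
  ∧-elim {A} ⟨ p ⟩ = let a , b = ∧ᵇ-true⁻ (eval v w A) p in ⟨ a ⟩ , ⟨ b ⟩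

  ∨-introˡ : ∀ {A B} → ⊩ A → ⊩ A ∨′ B
  ∨-introˡ {B = B} ⟨ a ⟩ = ⟨ cong (_∨ᵇ eval v w B) a ⟩

  ∨-introʳ : ∀ {A B} → ⊩ B → ⊩ A ∨′ B
  ∨-introʳ {A} ⟨ b ⟩ = ⟨ ≡-trans (cong (eval v w A ∨ᵇ_) b) (∨-zeroʳ _) ⟩

  ∨-elim : ∀ {A B} → ⊩ A ∨′ B → (⊩ A) ⊎ (⊩ B)
  ∨-elim {A} ⟨ p ⟩ = [ inj₁ ∘ ⟨_⟩ , inj₂ ∘ ⟨_⟩ ]′ (lemma (eval v w A) p)
    where
    lemma : ∀ a {b} → a ∨ᵇ b ≡ true → a ≡ true ⊎ b ≡ true
    lemma true  p = inj₁ ≡-refl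
    lemma false p = inj₂ p

  ∨⊥-elim : ∀ {A} → ⊩ A ∨′ ⊥′ → ⊩ A
  ∨⊥-elim h = [ (λ a → a) , ⊥′-elim ]′ (∨-elim h)

  excluded-middle : ∀ A → (⊩ A) ⊎ (⊩ ¬′ A)
  excluded-middle A = lemma (eval v w A) ≡-refl
    where
    lemma : ∀ a → eval v w A ≡ a → (⊩ A) ⊎ (⊩ ¬′ A)
    lemma true  eq = inj₁ ⟨ eq ⟩
    lemma false eq = inj₂ ⟨ cong (λ a → not a ∨ᵇ false) eq ⟩

-- Derivations in GL

infer₀ : ∀ {A} → (∀ {v w} → Holds v w A) → GL⊢ A
infer₀ f = taut λ v w → holds (f {v} {w})

infer₁ : ∀ {A B} → (∀ {v w} → Holds v w A → Holds v w B) → GL⊢ A → GL⊢ B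
infer₁ f = mp (infer₀ (⇒-intro f))

infer₂ : ∀ {A B C} → (∀ {v w} → Holds v w A → Holds v w B → Holds v w C) →
         GL⊢ A → GL⊢ B → GL⊢ C
infer₂ f a = mp (infer₁ (λ a → ⇒-intro (f a)) a)

⇒-trans : ∀ {A B C} → GL⊢ A ⇒′ B → GL⊢ B ⇒′ C → GL⊢ A ⇒′ C
⇒-trans = infer₂ λ f g → ⇒-intro (⇒-elim g ∘ ⇒-elim f)

□-mono : ∀ {A B} → GL⊢ A ⇒′ B → GL⊢ □′ A ⇒′ □′ B
□-mono f = mp K (nec f)

□-mono₂ : ∀ {A B C} → GL⊢ A ⇒′ B ⇒′ C → GL⊢ □′ A ⇒′ □′ B ⇒′ □′ C
□-mono₂ f = ⇒-trans (□-mono f) K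

-- Löb's axiom for A ∧ □A.
□-4 : ∀ {A} → GL⊢ □′ A ⇒′ □′ (A ∧′ □′ A)
□-4 {A} = ⇒-trans (□-mono (infer₁ lemma (□-mono {A ∧′ □′ A} (infer₀ (⇒-intro (proj₁ ∘ ∧-elim)))))) löb
  where
  lemma : ∀ {v w} → Holds v w (□′ (A ∧′ □′ A) ⇒′ □′ A) → Holds v w (A ⇒′ □′ (A ∧′ □′ A) ⇒′ A ∧′ □′ A)
  lemma f = ⇒-intro λ a → ⇒-intro λ b → ∧-intro a (⇒-elim f b)

-- The half of De Morgan duality behind rule (□): it makes the disjunct `◇ (A ᗮ)` of the premise
-- contradict `□ A`.
noncontradiction : ∀ A → GL⊢ ⌜ A ⌝ ⇒′ ¬′ ⌜ A ᗮ ⌝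
noncontradiction (pos a) = infer₀ (⇒-intro λ p → ⇒-intro λ n → ⇒-elim n p)
noncontradiction (neg a) = infer₀ (⇒-intro λ n → n)
noncontradiction (A ∧ B) = infer₂
  (λ f g → ⇒-intro λ c → ⇒-intro λ d → case ∨-elim d of λ where
    (inj₁ a) → ⇒-elim (⇒-elim f (proj₁ (∧-elim c))) a
    (inj₂ b) → ⇒-elim (⇒-elim g (proj₂ (∧-elim c))) b)
  (noncontradiction A) (noncontradiction B)
noncontradiction (A ∨ B) = infer₂
  (λ f g → ⇒-intro λ d → ⇒-intro λ c → case ∨-elim d of λ where
    (inj₁ a) → ⇒-elim (⇒-elim f a) (proj₁ (∧-elim c))
    (inj₂ b) → ⇒-elim (⇒-elim g b) (proj₂ (∧-elim c)))
  (noncontradiction A) (noncontradiction B)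
noncontradiction (□ A) = infer₁
  (λ f → ⇒-intro λ a → ⇒-intro λ n → ⇒-elim n (⇒-elim f a))
  (□-mono (noncontradiction A))
noncontradiction (◇ A) = infer₁
  (λ f → ⇒-intro λ n → ⇒-intro λ a → ⇒-elim n (⇒-elim f a))
  (□-mono (infer₁ (λ f → ⇒-intro λ b → ⇒-intro λ a → ⇒-elim (⇒-elim f a) b) (noncontradiction A)))

-- Soundness: sequents as formulas

⌜_⌝ᵢ : Item → Modal
⌜_⌝ₛ : Sequent → Modal
⌜ fm A ⌝ᵢ  = ⌜ A ⌝
⌜ box Γ ⌝ᵢ = □′ ⌜ Γ ⌝ₛ
⌜ [] ⌝ₛ    = ⊥′
⌜ i ∷ Γ ⌝ₛ = ⌜ i ⌝ᵢ ∨′ ⌜ Γ ⌝ₛ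

module _ {v : Atom → Bool} {w : Modal → Bool} where

  ++-holdsˡ : ∀ Γ {Δ} → Holds v w ⌜ Γ ⌝ₛ → Holds v w ⌜ Γ ++ Δ ⌝ₛ
  ++-holdsˡ []      h = ⊥′-elim h
  ++-holdsˡ (_ ∷ Γ) h = [ ∨-introˡ , ∨-introʳ ∘ ++-holdsˡ Γ ]′ (∨-elim h)

  ++-holdsʳ : ∀ Γ {Δ} → Holds v w ⌜ Δ ⌝ₛ → Holds v w ⌜ Γ ++ Δ ⌝ₛ
  ++-holdsʳ []      h = h
  ++-holdsʳ (_ ∷ Γ) h = ∨-introʳ (++-holdsʳ Γ h)

  ++-holds⁻ : ∀ Γ {Δ} → Holds v w ⌜ Γ ++ Δ ⌝ₛ → Holds v w ⌜ Γ ⌝ₛ ⊎ Holds v w ⌜ Δ ⌝ₛ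
  ++-holds⁻ []      h = inj₂ h
  ++-holds⁻ (_ ∷ Γ) h with ∨-elim h
  ... | inj₁ i = inj₁ (∨-introˡ i)
  ... | inj₂ g = [ inj₁ ∘ ∨-introʳ , inj₂ ]′ (++-holds⁻ Γ g)

  ++-holds-map₂ : ∀ Γ {Δ₁ Δ₂ Δ₃} →
                  (Holds v w ⌜ Δ₁ ⌝ₛ → Holds v w ⌜ Δ₂ ⌝ₛ → Holds v w ⌜ Δ₃ ⌝ₛ) →
                  Holds v w ⌜ Γ ++ Δ₁ ⌝ₛ → Holds v w ⌜ Γ ++ Δ₂ ⌝ₛ → Holds v w ⌜ Γ ++ Δ₃ ⌝ₛ
  ++-holds-map₂ Γ f p q with ++-holds⁻ Γ p | ++-holds⁻ Γ q
  ... | inj₁ g | _      = ++-holdsˡ Γ g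
  ... | inj₂ _ | inj₁ g = ++-holdsˡ Γ g
  ... | inj₂ a | inj₂ b = ++-holdsʳ Γ (f a b)

∨-mono : ∀ {A B C D} → GL⊢ A ⇒′ B → GL⊢ C ⇒′ D → GL⊢ A ∨′ C ⇒′ B ∨′ D
∨-mono = infer₂ λ f g → ⇒-intro λ h → [ ∨-introˡ ∘ ⇒-elim f , ∨-introʳ ∘ ⇒-elim g ]′ (∨-elim h)

∨-swap : ∀ {A B C} → GL⊢ A ∨′ B ∨′ C ⇒′ B ∨′ A ∨′ C
∨-swap = infer₀ (⇒-intro λ h →
  [ ∨-introʳ ∘ ∨-introˡ , (λ k → [ ∨-introˡ , ∨-introʳ ∘ ∨-introʳ ]′ (∨-elim k)) ]′ (∨-elim h))

≈ᵢ-sound : ∀ {i j} → i ≈ᵢ j → GL⊢ ⌜ i ⌝ᵢ ⇒′ ⌜ j ⌝ᵢ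
≈-sound  : ∀ {Γ Δ} → Γ ≈ Δ → GL⊢ ⌜ Γ ⌝ₛ ⇒′ ⌜ Δ ⌝ₛ
pointwise-sound : ∀ {Γ Δ} → Pointwise _≈ᵢ_ Γ Δ → GL⊢ ⌜ Γ ⌝ₛ ⇒′ ⌜ Δ ⌝ₛ
≈ᵢ-sound fm      = infer₀ (⇒-intro λ a → a)
≈ᵢ-sound (box p) = □-mono (≈-sound p)
≈-sound (refl p)     = pointwise-sound p
≈-sound (prep e p)   = ∨-mono (≈ᵢ-sound e) (≈-sound p)
≈-sound (swap e f p) = ⇒-trans (∨-mono (≈ᵢ-sound e) (∨-mono (≈ᵢ-sound f) (≈-sound p))) ∨-swap
≈-sound (trans p q)  = ⇒-trans (≈-sound p) (≈-sound q)
pointwise-sound []      = infer₀ (⇒-intro λ a → a)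
pointwise-sound (e ∷ p) = ∨-mono (≈ᵢ-sound e) (pointwise-sound p)

context-nec : ∀ C {Σ} → GL⊢ ⌜ Σ ⌝ₛ → GL⊢ ⌜ C ⟪ Σ ⟫ ⌝ₛ
context-nec (hole Δ)    p = infer₁ (++-holdsʳ Δ) p
context-nec (under Δ C) p = infer₁ (λ h → ++-holdsʳ Δ (∨-introˡ h)) (nec (context-nec C p))

-- Stated with two hypotheses to serve rule (∧), whose premises fill the same context; K carries the
-- implication through each bracket.
context-mono₂ : ∀ C {Σ₁ Σ₂ Σ₃} → GL⊢ ⌜ Σ₁ ⌝ₛ ⇒′ ⌜ Σ₂ ⌝ₛ ⇒′ ⌜ Σ₃ ⌝ₛ →
                GL⊢ ⌜ C ⟪ Σ₁ ⟫ ⌝ₛ ⇒′ ⌜ C ⟪ Σ₂ ⟫ ⌝ₛ ⇒′ ⌜ C ⟪ Σ₃ ⟫ ⌝ₛ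
context-mono₂ (hole Δ) = infer₁ λ f → ⇒-intro λ p → ⇒-intro λ q →
  ++-holds-map₂ Δ (λ a b → ⇒-elim (⇒-elim f a) b) p q
context-mono₂ (under Δ C) f = infer₁
  (λ f → ⇒-intro λ p → ⇒-intro λ q → ++-holds-map₂ Δ
    (λ a b → ∨-introˡ (⇒-elim (⇒-elim f (∨⊥-elim a)) (∨⊥-elim b))) p q)
  (□-mono₂ (context-mono₂ C f))

context-mono : ∀ C {Σ₁ Σ₂} → GL⊢ ⌜ Σ₁ ⌝ₛ ⇒′ ⌜ Σ₂ ⌝ₛ → GL⊢ ⌜ C ⟪ Σ₁ ⟫ ⌝ₛ → GL⊢ ⌜ C ⟪ Σ₂ ⟫ ⌝ₛ
context-mono C f p = mp (mp (context-mono₂ C (infer₁ (λ f → ⇒-intro λ _ → f) f)) p) p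

-- The hypothesis is paired so that it survives descent: `¬′ ⌜ A ⌝` acts if the hole is here, while
-- `□′ ¬′ ⌜ A ⌝` yields the whole pair inside a bracket by `□-4`.
context-erase : ∀ C A → GL⊢ (¬′ ⌜ A ⌝ ∧′ □′ ¬′ ⌜ A ⌝) ⇒′ ⌜ C ⟪ [ fm A ] ⟫ ⌝ₛ ⇒′ ⌜ C ⟪ [] ⟫ ⌝ₛ
under-erase : ∀ Δ C A → GL⊢ □′ ¬′ ⌜ A ⌝ ⇒′ ⌜ under Δ C ⟪ [ fm A ] ⟫ ⌝ₛ ⇒′ ⌜ under Δ C ⟪ [] ⟫ ⌝ₛ
context-erase (hole Δ) A = infer₀ (⇒-intro λ n → ⇒-intro λ p → ++-holds-map₂ Δ
  (λ a _ → ⊥′-elim (⇒-elim (proj₁ (∧-elim n)) (∨⊥-elim a))) p p)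
context-erase (under Δ C) A =
  infer₁ (λ f → ⇒-intro λ n → ⇒-elim f (proj₂ (∧-elim n))) (under-erase Δ C A)
under-erase Δ C A = infer₁
  (λ f → ⇒-intro λ n → ⇒-intro λ p → ++-holds-map₂ Δ
    (λ a _ → ∨-introˡ (⇒-elim (⇒-elim f n) (∨⊥-elim a))) p p)
  (⇒-trans □-4 (□-mono₂ (context-erase C A)))

cutfree-sound : ∀ {Γ} → CutFree Γ → GL⊢ ⌜ Γ ⌝ₛ
cutfree-sound (exch p d) = mp (≈-sound p) (cutfree-sound d)
cutfree-sound (idR Γ a) = context-nec Γ
  (infer₀ ([ (λ p → ∨-introʳ (∨-introˡ p)) , ∨-introˡ ]′ (excluded-middle (var a))))
cutfree-sound (∧R Γ A B d e) = mp (mp (context-mono₂ Γ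
  (infer₀ (⇒-intro λ a → ⇒-intro λ b → ∨-introˡ (∧-intro (∨⊥-elim a) (∨⊥-elim b)))))
  (cutfree-sound d)) (cutfree-sound e)
cutfree-sound (∨R Γ A B d) = context-mono Γ
  (infer₀ (⇒-intro λ h → ∨-introˡ ([ ∨-introˡ , ∨-introʳ ∘ ∨⊥-elim ]′ (∨-elim h))))
  (cutfree-sound d)
cutfree-sound (□R Γ A d) = context-mono Γ
  (infer₁ (λ f → ⇒-intro λ h → ∨-introˡ (⇒-elim f (∨⊥-elim h)))
    (⇒-trans (□-mono löb-premise) löb))
  (cutfree-sound d)
  where
  -- With `◇ (A ᗮ)` read as the negation of `□ A`, the contents of the bracket are the antecedent of
  -- Löb's axiom.
  löb-premise : GL⊢ ⌜ fm (◇ (A ᗮ)) ∷ fm A ∷ [] ⌝ₛ ⇒′ □′ ⌜ A ⌝ ⇒′ ⌜ A ⌝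
  löb-premise = infer₁
    (λ f → ⇒-intro λ h → ⇒-intro λ a → case ∨-elim h of λ where
      (inj₁ d) → ⊥′-elim (⇒-elim d (⇒-elim f a))
      (inj₂ b) → ∨⊥-elim b)
    (□-mono (noncontradiction A))
cutfree-sound (◇R Γ (hole _) A () d)
cutfree-sound (◇R Γ (under Δ C) A _ d) = context-mono Γ
  (infer₁ (λ f → ⇒-intro λ h → case ++-holds⁻ (under Δ C ⟪ [ fm A ] ⟫) h of λ where
      (inj₂ a) → ++-holdsʳ (under Δ C ⟪ [] ⟫) a
      -- Either `A` fails at all successors and can be erased from the hole, or the negation of this
      -- is literally `⌜ ◇ A ⌝`, which the conclusion contains.
      (inj₁ s) → case excluded-middle (□′ ¬′ ⌜ A ⌝) of λ where
        (inj₁ n) → ++-holdsˡ (under Δ C ⟪ [] ⟫) (⇒-elim (⇒-elim f n) s)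
        (inj₂ p) → ++-holdsʳ (under Δ C ⟪ [] ⟫) (∨-introˡ p))
    (under-erase Δ C A))
  (cutfree-sound d)

-- Finite tree models

data Tree : Set where
  node : (Atom → Bool) → List Tree → Tree

-- Recursion into both the subtrees and the siblings makes accessibility transitive. Serving as the
-- valuation of boxed formulas, it turns `eval` into forcing.
everywhere : List Tree → Modal → Bool
everywhere []               A = true
everywhere (node v us ∷ ts) A = eval v (everywhere us) A ∧ᵇ (everywhere us A ∧ᵇ everywhere ts A)

infix 4 _⊨_
_⊨_ : Tree → Modal → Set
node v ts ⊨ A = Holds v (everywhere ts) A

record Everywhere (ts : List Tree) (A : Modal) : Set where
  constructor ⟦_⟧
  field everywhere-true : everywhere ts A ≡ true

□-holds⁺ : ∀ {v ts A} → Everywhere ts A → Holds v (everywhere ts) (□′ A)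
□-holds⁺ ⟦ p ⟧ = ⟨ p ⟩

□-holds⁻ : ∀ {v ts A} → Holds v (everywhere ts) (□′ A) → Everywhere ts A
□-holds⁻ ⟨ p ⟩ = ⟦ p ⟧

children : Tree → List Tree
children (node _ ts) = ts

module _ {v : Atom → Bool} {us ts : List Tree} {A : Modal} where

  Everywhere-∷⁺ : node v us ⊨ A → Everywhere us A → Everywhere ts A → Everywhere (node v us ∷ ts) A
  Everywhere-∷⁺ ⟨ a ⟩ ⟦ p ⟧ ⟦ q ⟧ = ⟦ cong₂ _∧ᵇ_ a (cong₂ _∧ᵇ_ p q) ⟧

  Everywhere-∷⁻ : Everywhere (node v us ∷ ts) A → (node v us ⊨ A) × Everywhere us A × Everywhere ts A
  Everywhere-∷⁻ ⟦ p ⟧ =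
    let a , q = ∧ᵇ-true⁻ (eval v (everywhere us) A) p
        b , c = ∧ᵇ-true⁻ (everywhere us A) q
    in ⟨ a ⟩ , ⟦ b ⟧ , ⟦ c ⟧

Everywhere-nec : ∀ ts {A} → (∀ t → t ⊨ A) → Everywhere ts A
Everywhere-nec []               f = ⟦ ≡-refl ⟧
Everywhere-nec (node v us ∷ ts) f =
  Everywhere-∷⁺ (f (node v us)) (Everywhere-nec us f) (Everywhere-nec ts f)

Everywhere-K : ∀ ts {A B} → Everywhere ts (A ⇒′ B) → Everywhere ts A → Everywhere ts B
Everywhere-K []               _ _ = ⟦ ≡-refl ⟧
Everywhere-K (node v us ∷ ts) {A} p q =
  let f , g , h = Everywhere-∷⁻ p
      a , b , c = Everywhere-∷⁻ q
  in Everywhere-∷⁺ (⇒-elim f a) (Everywhere-K us g b) (Everywhere-K ts h c)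

-- Induction on the tree: once `A` holds at everything below a node, `□′ A` holds at the node, and
-- the assumption there gives `A`.
Everywhere-löb : ∀ ts {A} → Everywhere ts (□′ A ⇒′ A) → Everywhere ts A
Everywhere-löb []               _ = ⟦ ≡-refl ⟧
Everywhere-löb (node v us ∷ ts) p =
  let f , g , h = Everywhere-∷⁻ p
      below     = Everywhere-löb us g
  in Everywhere-∷⁺ (⇒-elim f (□-holds⁺ below)) below (Everywhere-löb ts h)

GL-sound : ∀ {A} → GL⊢ A → ∀ t → t ⊨ A
GL-sound (taut p) (node v ts) = ⟨ p v (everywhere ts) ⟩
GL-sound K        (node v ts) = ⇒-intro λ f → ⇒-intro λ a → □-holds⁺ (Everywhere-K ts (□-holds⁻ f) (□-holds⁻ a))
GL-sound löb      (node v ts) = ⇒-intro λ f → □-holds⁺ (Everywhere-löb ts (□-holds⁻ f))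
GL-sound (mp f a) (node v ts) = ⇒-elim (GL-sound f (node v ts)) (GL-sound a (node v ts))
GL-sound (nec a)  (node v ts) = □-holds⁺ (Everywhere-nec ts (GL-sound a))

-- Exchange and contexts

≈ᵢ-refl : ∀ {i} → i ≈ᵢ i
pointwise-refl : ∀ Γ → Pointwise _≈ᵢ_ Γ Γ
≈ᵢ-refl {fm A}  = fm
≈ᵢ-refl {box Γ} = box (refl (pointwise-refl Γ))
pointwise-refl []      = []
pointwise-refl (i ∷ Γ) = ≈ᵢ-refl ∷ pointwise-refl Γ

≈-reflexive : ∀ {Γ Δ} → Γ ≡ Δ → Γ ≈ Δ
≈-reflexive ≡-refl = refl (pointwise-refl _)

↭⇒≈ : ∀ {Γ Δ} → Γ ↭ Δ → Γ ≈ Δ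
↭⇒≈ ↭.refl         = ≈-reflexive ≡-refl
↭⇒≈ (↭.prep _ p)   = prep ≈ᵢ-refl (↭⇒≈ p)
↭⇒≈ (↭.swap _ _ p) = swap ≈ᵢ-refl ≈ᵢ-refl (↭⇒≈ p)
↭⇒≈ (↭.trans p q)  = trans (↭⇒≈ p) (↭⇒≈ q)

≈-++ˡ : ∀ Γ {Δ Δ′} → Δ ≈ Δ′ → Γ ++ Δ ≈ Γ ++ Δ′
≈-++ˡ []      p = p
≈-++ˡ (i ∷ Γ) p = prep ≈ᵢ-refl (≈-++ˡ Γ p)

context-≈ : ∀ C {Γ Δ} → Γ ≈ Δ → C ⟪ Γ ⟫ ≈ C ⟪ Δ ⟫
context-≈ (hole Θ)    p = ≈-++ˡ Θ p
context-≈ (under Θ C) p = ≈-++ˡ Θ (prep (box (context-≈ C p)) (refl []))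

context-↭ : ∀ C {Γ Δ} → Γ ↭ Δ → CutFree C ⟪ Γ ⟫ → CutFree C ⟪ Δ ⟫
context-↭ C p = exch (context-≈ C (↭⇒≈ p))

infixl 8 _◂_ _▸_

-- Absorbs the side formulas of a leaf into the context, leaving only the principal formulas in the
-- hole.
_◂_ : Context → Sequent → Context
hole Δ    ◂ Θ = hole (Δ ++ Θ)
under Δ C ◂ Θ = under Δ (C ◂ Θ)

-- The context seen from a new child bracket of a leaf with contents `Θ`.
_▸_ : Context → Sequent → Context
hole Δ    ▸ Θ = under (Δ ++ Θ) (hole [])
under Δ C ▸ Θ = under Δ (C ▸ Θ)

◂-fill : ∀ C Θ Γ → (C ◂ Θ) ⟪ Γ ⟫ ≡ C ⟪ Θ ++ Γ ⟫
◂-fill (hole Δ)    Θ Γ = ++-assoc Δ Θ Γ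
◂-fill (under Δ C) Θ Γ = cong (λ X → Δ ++ [ box X ]) (◂-fill C Θ Γ)

▸-fill : ∀ C Θ Γ → (C ▸ Θ) ⟪ Γ ⟫ ≡ C ⟪ Θ ++ [ box Γ ] ⟫
▸-fill (hole Δ)    Θ Γ = ++-assoc Δ Θ _
▸-fill (under Δ C) Θ Γ = cong (λ X → Δ ++ [ box X ]) (▸-fill C Θ Γ)

depth-◂ : ∀ C Θ → depth (C ◂ Θ) ≡ depth C
depth-◂ (hole Δ)    Θ = ≡-refl
depth-◂ (under Δ C) Θ = cong suc (depth-◂ C Θ)

depth-▸ : ∀ C Θ → depth (C ▸ Θ) > 0
depth-▸ (hole Δ)    Θ = s≤s z≤n
depth-▸ (under Δ C) Θ = s≤s z≤n

-- ◇A occurs in C at a strict ancestor of the hole.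
record Above (C : Context) (A : Formula) : Set where
  field
    outer inner : Context
    deep        : depth inner > 0
    split       : ∀ Γ → C ⟪ Γ ⟫ ≈ outer ⟪ inner ⟪ Γ ⟫ ++ [ fm (◇ A) ] ⟫
    unsplit     : ∀ Γ → outer ⟪ inner ⟪ Γ ⟫ ++ [ fm (◇ A) ] ⟫ ≈ C ⟪ Γ ⟫

module _ {C : Context} {A : Formula} where
  open Above

  -- Rule (◇) at the recorded ancestor, with `Γ` absorbed into the inner context; this leaves the
  -- depth of that context positive.
  ◇-above : Above C A → ∀ Γ → CutFree C ⟪ Γ ++ [ fm A ] ⟫ → CutFree C ⟪ Γ ⟫
  ◇-above p Γ d = exch (unsplit p Γ)
    (subst (λ Γ′ → CutFree outer p ⟪ inner p ⟪ Γ′ ⟫ ++ [ fm (◇ A) ] ⟫) (++-identityʳ Γ)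
      (subst (λ X → CutFree outer p ⟪ X ++ [ fm (◇ A) ] ⟫) (◂-fill (inner p) Γ [])
        (◇R (outer p) (inner p ◂ Γ) A (subst (_> 0) (≡-sym (depth-◂ (inner p) Γ)) (deep p))
          (subst (λ X → CutFree outer p ⟪ X ++ [ fm (◇ A) ] ⟫) (≡-sym (◂-fill (inner p) Γ _))
            (exch (split p _) d)))))

  above-▸ : ∀ Θ → Above C A → Above (C ▸ Θ) A
  above-▸ Θ p = record
    { outer   = outer p
    ; inner   = inner p ▸ Θ
    ; deep    = depth-▸ (inner p) Θ
    ; split   = λ Γ → trans (≈-reflexive (▸-fill C Θ Γ))
        (trans (split p _) (≈-reflexive (≡-sym (inside Γ))))
    ; unsplit = λ Γ → trans (≈-reflexive (inside Γ))
        (trans (unsplit p _) (≈-reflexive (≡-sym (▸-fill C Θ Γ))))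
    }
    where
    inside : ∀ Γ → outer p ⟪ (inner p ▸ Θ) ⟪ Γ ⟫ ++ [ fm (◇ A) ] ⟫
                 ≡ outer p ⟪ inner p ⟪ Θ ++ [ box Γ ] ⟫ ++ [ fm (◇ A) ] ⟫
    inside Γ = cong (λ X → outer p ⟪ X ++ [ fm (◇ A) ] ⟫) (▸-fill (inner p) Θ Γ)

extract : ∀ {X : Set} {x : X} {xs} → x ∈ xs → ∃ λ ys → xs ↭ x ∷ ys
extract {x = x} p with ys , zs , ≡-refl ← ∈-∃++ p = ys ++ zs , shift x ys zs

above-here : ∀ C {Θ A} → fm (◇ A) ∈ Θ → Above (C ▸ Θ) A
above-here C {Θ} {A} p with Θ′ , q ← extract p = record
  { outer   = C
  ; inner   = under Θ′ (hole [])
  ; deep    = s≤s z≤n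
  ; split   = λ Γ → trans (≈-reflexive (▸-fill C Θ Γ)) (context-≈ C (↭⇒≈ (move Γ)))
  ; unsplit = λ Γ → trans (context-≈ C (↭⇒≈ (↭-sym (move Γ)))) (≈-reflexive (≡-sym (▸-fill C Θ Γ)))
  }
  where
  move : ∀ Γ → Θ ++ [ box Γ ] ↭ (Θ′ ++ [ box Γ ]) ++ [ fm (◇ A) ]
  move Γ = ↭-trans (++⁺ʳ [ box Γ ] q) (∷↭∷ʳ (fm (◇ A)) (Θ′ ++ [ box Γ ]))

-- A calculus for the leaf of a branch

-- D lists the bodies of the ◇-formulas at the strict ancestors of the leaf, E those at
-- the leaf itself, and Γ the other formulas of the leaf.
data Der : List Formula → List Formula → List Formula → Set where
  exchange : ∀ {D E Γ Δ} → Γ ↭ Δ → Der D E Γ → Der D E Δ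
  axiom    : ∀ {D E Γ a} → Der D E (neg a ∷ pos a ∷ Γ)
  ∧-rule   : ∀ {D E Γ A B} → Der D E (A ∷ Γ) → Der D E (B ∷ Γ) → Der D E (A ∧ B ∷ Γ)
  ∨-rule   : ∀ {D E Γ A B} → Der D E (A ∷ B ∷ Γ) → Der D E (A ∨ B ∷ Γ)
  ◇-rule   : ∀ {D E Γ A} → Der D (A ∷ E) Γ → Der D E (◇ A ∷ Γ)
  □-rule   : ∀ {D E Γ A} → Der (E ++ D) [ A ᗮ ] [ A ] → Der D E (□ A ∷ Γ)
  inherit  : ∀ {D E Γ A} → A ∈ D → Der D E (A ∷ Γ) → Der D E Γ

leaf : List Formula → List Formula → Sequent
leaf E Γ = map fm (map ◇_ E ++ Γ)

leaf-focus : ∀ E Π Γ → leaf E (Π ++ Γ) ↭ leaf E Γ ++ map fm Π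
leaf-focus E Π Γ = ↭-trans (map⁺ fm (↭-trans (shifts (map ◇_ E) Π) (++-comm Π (map ◇_ E ++ Γ))))
  (↭-reflexive (map-++ fm (map ◇_ E ++ Γ) Π))

leaf-unfocus : ∀ C E Π Γ → CutFree (C ◂ leaf E Γ) ⟪ map fm Π ⟫ → CutFree C ⟪ leaf E (Π ++ Γ) ⟫
leaf-unfocus C E Π Γ d = context-↭ C (↭-sym (leaf-focus E Π Γ)) (subst CutFree_ (◂-fill C (leaf E Γ) _) d)

leaf-refocus : ∀ C E Π Γ → CutFree C ⟪ leaf E (Π ++ Γ) ⟫ → CutFree (C ◂ leaf E Γ) ⟪ map fm Π ⟫
leaf-refocus C E Π Γ d = subst CutFree_ (≡-sym (◂-fill C (leaf E Γ) _)) (context-↭ C (leaf-focus E Π Γ) d)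

-- The context is arbitrary apart from the ancestors listed in `D`, so the formulas that `□-rule`
-- discards can live on in `C ▸ leaf E Γ`.
der⇒cutfree : ∀ {D E Γ} → Der D E Γ → ∀ C → (∀ {A} → A ∈ D → Above C A) → CutFree C ⟪ leaf E Γ ⟫
der⇒cutfree {E = E} (exchange p d) C h = context-↭ C (map⁺ fm (++⁺ˡ (map ◇_ E) p)) (der⇒cutfree d C h)
der⇒cutfree {E = E} (axiom {Γ = Γ} {a}) C h = leaf-unfocus C E (neg a ∷ pos a ∷ []) Γ (idR (C ◂ leaf E Γ) a)
der⇒cutfree {E = E} (∧-rule {Γ = Γ} {A} {B} d e) C h = leaf-unfocus C E [ A ∧ B ] Γ
  (∧R (C ◂ leaf E Γ) A B
    (leaf-refocus C E [ A ] Γ (der⇒cutfree d C h))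
    (leaf-refocus C E [ B ] Γ (der⇒cutfree e C h)))
der⇒cutfree {E = E} (∨-rule {Γ = Γ} {A} {B} d) C h = leaf-unfocus C E [ A ∨ B ] Γ
  (∨R (C ◂ leaf E Γ) A B (leaf-refocus C E (A ∷ B ∷ []) Γ (der⇒cutfree d C h)))
der⇒cutfree {E = E} (◇-rule {Γ = Γ} {A} d) C h =
  context-↭ C (map⁺ fm (↭-sym (shift (◇ A) (map ◇_ E) Γ))) (der⇒cutfree d C h)
der⇒cutfree {D} {E} (□-rule {Γ = Γ} {A} d) C h = leaf-unfocus C E [ □ A ] Γ
  (□R (C ◂ leaf E Γ) A
    (subst CutFree_ (≡-trans (▸-fill C (leaf E Γ) _) (≡-sym (◂-fill C (leaf E Γ) _)))
      (der⇒cutfree d (C ▸ leaf E Γ) above)))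
  where
  above : ∀ {B} → B ∈ E ++ D → Above (C ▸ leaf E Γ) B
  above p with ∈-++⁻ E p
  ... | inj₁ q = above-here C (∈-map⁺ fm (∈-++⁺ˡ (∈-map⁺ ◇_ q)))
  ... | inj₂ q = above-▸ (leaf E Γ) (h q)
der⇒cutfree {E = E} {Γ} (inherit {A = A} p d) C h = ◇-above (h p) (leaf E Γ)
  (context-↭ C (leaf-focus E [ A ] Γ) (der⇒cutfree d C h))

-- Negation and identity in the leaf calculus

ᗮ-involutive : ∀ A → (A ᗮ) ᗮ ≡ A
ᗮ-involutive (pos a) = ≡-refl
ᗮ-involutive (neg a) = ≡-refl
ᗮ-involutive (A ∧ B) = cong₂ _∧_ (ᗮ-involutive A) (ᗮ-involutive B)
ᗮ-involutive (A ∨ B) = cong₂ _∨_ (ᗮ-involutive A) (ᗮ-involutive B)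
ᗮ-involutive (□ A)   = cong □_ (ᗮ-involutive A)
ᗮ-involutive (◇ A)   = cong ◇_ (ᗮ-involutive A)

identity : ∀ A {D E Γ} → Der D E (A ∷ A ᗮ ∷ Γ)
identity (pos a) = exchange (↭-swap _ _ ↭-refl) axiom
identity (neg a) = axiom
identity (A ∧ B) {Γ = Γ} = ∧-rule
  (under-∨ (exchange (↭-sym (shift A (A ᗮ ∷ B ᗮ ∷ []) Γ)) (identity A)))
  (under-∨ (exchange (↭-trans (↭-prep B (↭-swap _ _ ↭-refl)) (↭-sym (shift B (A ᗮ ∷ B ᗮ ∷ []) Γ))) (identity B)))
  where
  under-∨ : ∀ {D E F} → Der D E (A ᗮ ∷ B ᗮ ∷ F ∷ Γ) → Der D E (F ∷ (A ∧ B) ᗮ ∷ Γ)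
  under-∨ = exchange (↭-swap _ _ ↭-refl) ∘ ∨-rule
identity (A ∨ B) {Γ = Γ} = ∨-rule (exchange (↭-sym (shift _ (A ∷ B ∷ []) Γ)) (∧-rule
  (exchange (shift (A ᗮ) (A ∷ []) _) (identity A))
  (exchange (↭-trans (shift (B ᗮ) (B ∷ []) _) (↭-prep _ (↭-sym (shift B (A ∷ []) Γ)))) (identity B))))
-- The dual ◇-formula is recorded first, so that the child opened for `□ A` can inherit `A ᗮ`.
identity (□ A) = exchange (↭-swap _ _ ↭-refl)
  (◇-rule (□-rule (inherit (here ≡-refl) (exchange (↭-swap _ _ ↭-refl) (identity A)))))
identity (◇ A) = ◇-rule (□-rule (inherit (here ≡-refl) (identity A)))

-- Proof search

-- The bodies of the □-formulas that occur in A or Aᗮ.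
boxes : Formula → List Formula
boxes (pos a) = []
boxes (neg a) = []
boxes (A ∧ B) = boxes A ++ boxes B
boxes (A ∨ B) = boxes A ++ boxes B
boxes (□ A)   = A ∷ boxes A
boxes (◇ A)   = A ᗮ ∷ boxes A

boxes-ᗮ : ∀ A → boxes (A ᗮ) ≡ boxes A
boxes-ᗮ (pos a) = ≡-refl
boxes-ᗮ (neg a) = ≡-refl
boxes-ᗮ (A ∧ B) = cong₂ _++_ (boxes-ᗮ A) (boxes-ᗮ B)
boxes-ᗮ (A ∨ B) = cong₂ _++_ (boxes-ᗮ A) (boxes-ᗮ B)
boxes-ᗮ (□ A)   = cong₂ _∷_ (ᗮ-involutive A) (boxes-ᗮ A)
boxes-ᗮ (◇ A)   = cong (A ᗮ ∷_) (boxes-ᗮ A)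

-- Modal formulas count as one because saturating a leaf never enters their bodies.
size : Formula → ℕ
size (A ∧ B) = suc (size A + size B)
size (A ∨ B) = suc (size A + size B)
size _       = 1

total : List Formula → ℕ
total = sum ∘ map size

-- Refutation in tree models

infix 4 _⊭_
_⊭_ : Tree → Formula → Set
t ⊭ A = t ⊨ ¬′ ⌜ A ⌝

Absent : List Tree → Formula → Set
Absent ts A = Everywhere ts (¬′ ⌜ A ⌝)

-- `U` collects ◇-bodies: `below` is what refutes the corresponding ◇-formulas at the root, and it
-- speaks of all proper descendants at once.
record Refutes (U Γ : List Formula) (t : Tree) : Set where
  constructor refutes
  field
    below : All (Absent (children t)) U
    at    : All (t ⊭_) Γ
open Refutes

module _ {v : Atom → Bool} {w : Modal → Bool} where

  ∧-refute : ∀ {A B} → Holds v w (¬′ A) ⊎ Holds v w (¬′ B) → Holds v w (¬′ (A ∧′ B))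
  ∧-refute (inj₁ n) = ⇒-intro (⇒-elim n ∘ proj₁ ∘ ∧-elim)
  ∧-refute (inj₂ n) = ⇒-intro (⇒-elim n ∘ proj₂ ∘ ∧-elim)

  ∨-refute : ∀ {A B} → Holds v w (¬′ A) → Holds v w (¬′ B) → Holds v w (¬′ (A ∨′ B))
  ∨-refute m n = ⇒-intro ([ ⇒-elim m , ⇒-elim n ]′ ∘ ∨-elim)

  ¬¬-intro : ∀ {A} → Holds v w A → Holds v w (¬′ ¬′ A)
  ¬¬-intro a = ⇒-intro λ n → ⇒-elim n a

◇-refute : ∀ t {A} → Absent (children t) A → t ⊭ ◇ A
◇-refute (node v ts) p = ¬¬-intro (□-holds⁺ p)

Everywhere-∈ : ∀ {ts t A} → t ∈ ts → Everywhere ts A → t ⊨ A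
Everywhere-∈ {node v us ∷ ts} (here ≡-refl) p = proj₁ (Everywhere-∷⁻ p)
Everywhere-∈ {node v us ∷ ts} (there q)     p = Everywhere-∈ q (proj₂ (proj₂ (Everywhere-∷⁻ p)))

□-refute : ∀ {v ts A} → Any (_⊭ A) ts → node v ts ⊭ □ A
□-refute p with node u us , q , r ← find p =
  ⇒-intro λ a → ⟨ case holds (⇒-elim r (Everywhere-∈ q (□-holds⁻ a))) of (λ ()) ⟩

Everywhere⁺ : ∀ {ts A} → All (λ t → (t ⊨ A) × Everywhere (children t) A) ts → Everywhere ts A
Everywhere⁺ [] = ⟦ ≡-refl ⟧
Everywhere⁺ {node _ _ ∷ _} ((a , b) ∷ p) = Everywhere-∷⁺ a b (Everywhere⁺ p)

-- The shape of a saturated leaf, its ◇-formulas being recorded separately.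
residue : List Atom → List Atom → List Formula → List Formula
residue N P B = map neg N ++ map pos P ++ map □_ B

axiom-∈ : ∀ {D E Γ a} → neg a ∈ Γ → pos a ∈ Γ → Der D E Γ
axiom-∈ p q with Γ₁ , r ← extract p with there s ← ∈-resp-↭ r q with Γ₂ , t ← extract s =
  exchange (↭-sym (↭-trans r (↭-prep _ t))) axiom

□-rule-∈ : ∀ {D E Γ A} → □ A ∈ Γ → Der (E ++ D) [ A ᗮ ] [ A ] → Der D E Γ
□-rule-∈ p d = exchange (↭-sym (proj₂ (extract p))) (□-rule d)

-- Lets the search in a child start with every inherited ◇-body in its leaf, so that a failed search
-- falsifies them at the child itself.
inherit-all : ∀ {D E Γ} X → (∀ {A} → A ∈ X → A ∈ D) → Der D E (X ++ Γ) → Der D E Γ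
inherit-all []      _ d = d
inherit-all (A ∷ X) h d = inherit-all X (h ∘ there) (inherit (h (here ≡-refl)) d)

sequence : ∀ {X : Set} {Y : Formula → Set} (B : List Formula) →
           (∀ {A} → A ∈ B → X ⊎ Y A) → X ⊎ All Y B
sequence []      f = inj₂ []
sequence (A ∷ B) f with f (here ≡-refl) | sequence B (f ∘ there)
... | inj₁ x | _       = inj₁ x
... | inj₂ y | inj₁ x  = inj₁ x
... | inj₂ y | inj₂ ys = inj₂ (y ∷ ys)

-- The child is itself a descendant of the leaf, so `U` must fail both at it and below it; `A ᗮ`
-- comes from the ◇-formula that rule (□) adds.
ChildRefutation : List Formula → Formula → Set
ChildRefutation U A = ∃ (Refutes (A ᗮ ∷ U) (U ++ [ A ]))

module Countermodel {U : List Formula} where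

  -- One child for each boxed formula, as a witness against it. Every child respects all of `U`, so
  -- they can be placed under one root.
  gather : ∀ {B} → All (ChildRefutation U) B →
           ∃ λ ts → All (λ t → All (λ F → (t ⊭ F) × Absent (children t) F) U) ts ×
                    All (λ A → Any (_⊭ A) ts) B
  gather [] = [] , [] , []
  gather ((t , r) ∷ rs) =
    let ts , p , q   = gather rs
        atU , atA    = All.++⁻ U (at r)
    in t ∷ ts , All.zip (atU , All.tail (below r)) ∷ p , here (All.head atA) ∷ All.map there q

  model : ∀ N P B → (∀ {a} → a ∈ P → ¬ a ∈ N) →
          All (ChildRefutation U) B → ∃ (Refutes U (residue N P B))
  model N P B disjoint rs =
    let ts , p , q = gather rs
        -- Exactly the atoms of `N` are true, which falsifies their negations; `disjoint` makes
        -- those of `P` false.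
        t          = node (λ a → does (a ∈ℕ? N)) ts
    in t , refutes
      (All.tabulate λ F∈U → Everywhere⁺ (All.map (λ all → All.lookup all F∈U) p))
      (All.++⁺ (All.map⁺ (All.tabulate λ {a} a∈N → ¬¬-intro ⟨ dec-true (a ∈ℕ? N) a∈N ⟩))
        (All.++⁺ (All.map⁺ (All.tabulate λ {a} a∈P →
            ⟨ cong (λ b → not b ∨ᵇ false) (dec-false (a ∈ℕ? N) (disjoint a∈P)) ⟩))
          (All.map⁺ (All.map □-refute q))))
    where _∈ℕ?_ = _∈?_ _≟_

open Countermodel

Outcome : List Formula → List Formula → List Formula → Set
Outcome D E Γ = Der D E Γ ⊎ ∃ (Refutes (E ++ D) Γ)

outcome-map : ∀ {D E E′ Γ Δ} → (Der D E Γ → Der D E′ Δ) →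
              (∀ {t} → Refutes (E ++ D) Γ t → Refutes (E′ ++ D) Δ t) → Outcome D E Γ → Outcome D E′ Δ
outcome-map f g (inj₁ d)       = inj₁ (f d)
outcome-map f g (inj₂ (t , r)) = inj₂ (t , g r)

outcome-↭ : ∀ {D E Γ Δ} → Γ ↭ Δ → Outcome D E Γ → Outcome D E Δ
outcome-↭ p = outcome-map (exchange p) λ r → refutes (below r) (All-resp-↭ p (at r))

-- Saturation of a leaf and the budget of boxes

module Search (S : List Formula) where

  Within : Formula → Set
  Within A = All (_∈ S) (boxes A)

  -- R lists the bodies A of the □-formulas that have not yet been unfolded on the current branch.
  record Ready (R U : List Formula) : Set where
    constructor ready
    field
      within : All Within U
      budget : ∀ {A} → A ∈ S → A ∈ R ⊎ A ᗮ ∈ U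
  open Ready

  ready-∷ : ∀ {R U A} → Within A → Ready R U → Ready R (A ∷ U)
  ready-∷ wA r = ready (wA ∷ within r) (map₂ there ∘ budget r)

  -- The treatment of one box, abstracted so that the recursion saturating a leaf is separate from
  -- the recursion on the budget.
  Solver : List Formula → Set
  Solver R = ∀ {U A} → Ready R U → Within (□ A) → Der U [ A ᗮ ] [ A ] ⊎ ChildRefutation U A

  module _ {R : List Formula} (solve : Solver R) where

    -- For a leaf without an axiom, one provable box gives a proof; if every box fails, the
    -- refutations of all of them combine into a countermodel.
    branch : ∀ {D E} → Ready R (E ++ D) → ∀ N P B → All (Within ∘ □_) B → Outcome D E (residue N P B)
    branch r N P B wB with any? (λ a → _∈?_ _≟_ a N) P
    ... | yes p with a , a∈P , a∈N ← find p =
      inj₁ (axiom-∈ (∈-++⁺ˡ (∈-map⁺ neg a∈N)) (∈-++⁺ʳ (map neg N) (∈-++⁺ˡ (∈-map⁺ pos a∈P))))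
    ... | no ¬p = map₂ (model N P B λ a∈P a∈N → ¬p (lose a∈P a∈N)) (sequence B λ A∈B →
      map₁ (□-rule-∈ (∈-++⁺ʳ (map neg N) (∈-++⁺ʳ (map pos P) (∈-map⁺ □_ A∈B))))
        (solve r (All.lookup wB A∈B)))

    -- The rules for ∧, ∨ and ◇ are invertible: a tree refuting a premise refutes the conclusion, so
    -- no backtracking occurs here. The bound `m` drives the recursion.
    expand : ∀ D E → Ready R (E ++ D) → ∀ N P B → All (Within ∘ □_) B →
             ∀ m W → All Within W → total W ≤ m → Outcome D E (W ++ residue N P B)
    expand D E r N P B wB m [] _ _ = branch r N P B wB
    expand D E r N P B wB (suc m) (pos a ∷ W) (_ ∷ wW) (s≤s le) =
      outcome-↭ (↭-trans (++⁺ˡ W (shift (pos a) (map neg N) _)) (shift (pos a) W _))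
        (expand D E r N (a ∷ P) B wB m W wW le)
    expand D E r N P B wB (suc m) (neg a ∷ W) (_ ∷ wW) (s≤s le) =
      outcome-↭ (shift (neg a) W _) (expand D E r (a ∷ N) P B wB m W wW le)
    expand D E r N P B wB (suc m) (□ A ∷ W) (wA ∷ wW) (s≤s le) =
      outcome-↭ (↭-trans (++⁺ˡ W (↭-trans (++⁺ˡ (map neg N) (shift (□ A) (map pos P) _))
                                          (shift (□ A) (map neg N) _)))
                         (shift (□ A) W _))
        (expand D E r N P (A ∷ B) (wA ∷ wB) m W wW le)
    expand D E r N P B wB (suc m) (◇ A ∷ W) ((_ ∷ wA) ∷ wW) (s≤s le) =
      outcome-map ◇-rule
        -- The premise has `A` among its ◇-bodies; `x` says that `A` fails below the root, which
        -- refutes `◇ A` there.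
        (λ { (refutes (x ∷ xs) ys) → refutes xs (◇-refute _ x ∷ ys) })
        (expand D (A ∷ E) (ready-∷ wA r) N P B wB m W wW le)
    expand D E r N P B wB (suc m) (F ∧ G ∷ W) (wFG ∷ wW) (s≤s le)
      with expand D E r N P B wB m (F ∷ W) (All.++⁻ˡ (boxes F) wFG ∷ wW)
             (≤-trans (+-monoˡ-≤ (total W) (m≤m+n (size F) (size G))) le)
         | expand D E r N P B wB m (G ∷ W) (All.++⁻ʳ (boxes F) wFG ∷ wW)
             (≤-trans (+-monoˡ-≤ (total W) (m≤n+m (size G) (size F))) le)
    ... | inj₁ d | inj₁ e = inj₁ (∧-rule d e)
    ... | inj₂ (node v ts , refutes xs (y ∷ ys)) | _ =
      inj₂ (node v ts , refutes xs (∧-refute (inj₁ y) ∷ ys))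
    ... | inj₁ _ | inj₂ (node v ts , refutes xs (y ∷ ys)) =
      inj₂ (node v ts , refutes xs (∧-refute (inj₂ y) ∷ ys))
    expand D E r N P B wB (suc m) (F ∨ G ∷ W) (wFG ∷ wW) (s≤s le) =
      outcome-map ∨-rule
        (λ { {node v ts} (refutes xs (y ∷ z ∷ zs)) → refutes xs (∨-refute y z ∷ zs) })
        (expand D E r N P B wB m (F ∷ G ∷ W) (All.++⁻ˡ (boxes F) wFG ∷ All.++⁻ʳ (boxes F) wFG ∷ wW)
          (≤-trans (≤-reflexive (≡-sym (+-assoc (size F) (size G) (total W)))) le))

    search : ∀ D E Γ → Ready R (E ++ D) → All Within Γ → Outcome D E Γ
    search D E Γ r wΓ = outcome-↭ (↭-reflexive (++-identityʳ Γ)) (expand D E r [] [] [] [] _ Γ wΓ ≤-refl)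

  -- Unfolding `□ A` records `A ᗮ` among the ◇-bodies, and this pays for removing `A` from the
  -- budget.
  ready-spend : ∀ {R R′ U A} → R ↭ A ∷ R′ → Within A → Ready R U → Ready R′ (A ᗮ ∷ U)
  ready-spend {R} {R′} {U} {A} R↭ wA r =
    ready (subst (All (_∈ S)) (≡-sym (boxes-ᗮ A)) wA ∷ within r) (spend ∘ budget r)
    where
    spend : ∀ {B} → B ∈ R ⊎ B ᗮ ∈ U → B ∈ R′ ⊎ B ᗮ ∈ A ᗮ ∷ U
    spend (inj₂ p) = inj₂ (there p)
    spend (inj₁ p) with ∈-resp-↭ R↭ p
    ... | here ≡-refl = inj₂ (here ≡-refl)
    ... | there q     = inj₁ q

  -- If A ᗮ ∈ U, the premise of the □-rule is an instance of identity. Otherwise A leaves R,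
  -- which keeps the branches of the search tree finite.
  solver : ∀ n R → length R ≤ n → Solver R
  solver n R le {U} {A} r (A∈S ∷ wA) with budget r A∈S
  ... | inj₂ Aᗮ∈U = inj₁ (inherit Aᗮ∈U (exchange (↭-swap _ _ ↭-refl) (identity A)))
  ... | inj₁ A∈R with R′ , R↭ ← extract A∈R with n | ≤-trans (≤-reflexive (≡-sym (↭-length R↭))) le
  ...   | suc n′ | s≤s le′ = map₁ (inherit-all U (λ p → p))
    (search (solver n′ R′ le′) U [ A ᗮ ] (U ++ [ A ]) (ready-spend R↭ wA r) (All.++⁺ (within r) (wA ∷ [])))

-- Initially no box is unfolded: the budget is all of `boxes A`, and no ◇-body is recorded.
decide : ∀ A → Outcome [] [] [ A ]
decide A = search (solver _ (boxes A) ≤-refl) [] [] [ A ] (ready [] inj₁) (All.tabulate (λ p → p) ∷ [])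
  where open Search (boxes A)

cutfree-complete : ∀ A → GL⊢ ⌜ A ⌝ → CutFree [ fm A ]
cutfree-complete A p with decide A
... | inj₁ d = der⇒cutfree d (hole []) λ ()
... | inj₂ (node v ts , r) = case holds (⇒-elim (All.head (at r)) (GL-sound p (node v ts))) of λ ()

mainTheorem1 : (A : Formula) → (GL⊢ ⌜ A ⌝) ⇔ (CutFree [ fm A ])
mainTheorem1 A = mk⇔ (cutfree-complete A) (infer₁ ∨⊥-elim ∘ cutfree-sound)
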